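{- Let $Q$ be a combinatorially symmetric $S\times S$ transition rate matrix of a continuous-time homogeneous Markov chain with graph $\mathcal{G}(Q)$, and let $Z\subseteq\{1,\ldots,S\}$ be a set of observed states that is a zero forcing set of $\mathcal{G}(Q)$. Then the Markov chain is uniquely determined by the dynamics of the observed states. That is, if $Q'$ is any combinatorially symmetric $S\times S$ transition rate matrix with $\mathcal{G}(Q')=\mathcal{G}(Q)$ and $(\exp(Q't))_{ij}=(\exp(Qt))_{ij}$ for all $i,j\in Z$ and all $t\ge 0$, then $Q'=Q$.
   Context: Markov chains are homogeneous and finite with states $1,\ldots,S$. A transition rate matrix is a real $S\times S$ matrix $Q$ with $(Q)_{ij}\ge 0$ for $i\neq j$ and $(Q)_{ii}=-\sum_{j\neq i}(Q)_{ij}$ for all $i$. The corresponding transition matrix at time $t\in\mathbb{R}_{\ge 0}$ is $P(t)=\exp(Qt)$. A matrix $M$ is combinatorially symmetric if for all indices $i,j$, $(M)_{ij}\neq 0$ implies $(M)_{ji}\neq 0$. For a combinatorially symmetric matrix $M$ of order $S$, $\mathcal{G}(M)$ is the simple undirected graph on the vertices $1,\ldots,S$ in which $\{i,j\}$ with $i<j$ is an edge if and only if $(M)_{ij}\neq 0$ (diagonal entries are ignored). Zero forcing: given a simple graph, colour the vertices of a subset $Z$ blue. The colour propagates by the rules: (1) a blue vertex remains blue; (2) if a blue vertex $i$ has exactly one non-blue neighbour $j$, then $j$ becomes blue. $Z$ is a zero forcing set if eventually all vertices become blue. The dynamics of the observed states $Z$ is the collection of all values $P(t)_{ij}$ with $i,j\in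 Z$ and $t\ge 0$. The structure of the model (its graph) is regarded as known, and the matrix entries are the unknown parameters. -}

module Defs where

open import Level using (Level; _⊔_) renaming (suc to lsuc)
open import Algebra.Apartness.Bundles using (HeytingField)
open import Algebra.Bundles using (CommutativeRing)
open import Data.Bool.Base using (true; false; if_then_else_)
open import Data.Empty using (⊥-elim)
open import Data.Fin.Base as Fin using (Fin; toℕ)
import Data.Fin.Properties as Fin
open import Data.Fin.Subset using (Subset; _∈_; _∉_; _∪_; ⁅_⁆; ⊤)
open import Data.Nat.Base as ℕ using (ℕ; zero; suc; _!)
import Data.Nat.Properties as ℕ
open import Data.Product.Base using (_×_; _,_; ∃-syntax; proj₁; proj₂)
open import Data.Sum.Base using (_⊎_; inj₁; inj₂; [_,_]′; swap)
open import Data.Vec.Functional using (Vector)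
open import Function.Base using (_∘_)
open import Function.Bundles using (_⇔_)
open import Relation.Binary.Core using (Rel; _⇒_)
open import Relation.Binary.Construct.Closure.ReflexiveTransitive using (Star)
open import Relation.Binary.Definitions using (Symmetric; Irreflexive; Transitive; Trans)
open import Relation.Binary.PropositionalEquality.Core as ≡ using (_≡_; _≢_)
open import Relation.Binary.Structures using (IsStrictPartialOrder; IsPreorder)
open import Relation.Nullary.Decidable using (yes; no; does; ¬¬-excluded-middle)
open import Relation.Nullary.Negation using (¬_)

record OrderedField c ℓ₁ ℓ₂ : Set (lsuc (c ⊔ ℓ₁ ⊔ ℓ₂)) where
  infix 4 _<_ _≤_
  field
    heytingField : HeytingField c ℓ₁ ℓ₂

  open HeytingField heytingField public

  field
    _<_                  : Rel Carrier ℓ₂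
    isStrictPartialOrder : IsStrictPartialOrder _≈_ _<_
    <⇒#                  : ∀ {x y} → x < y → x # y
    #⇒<⊎>                : ∀ {x y} → x # y → x < y ⊎ y < x
    +-monoʳ-<            : ∀ x {y z} → y < z → x + y < x + z
    *-pos                : ∀ {x y} → 0# < x → 0# < y → 0# < x * y

  _≤_ : Rel Carrier ℓ₂
  x ≤ y = ¬ (y < x)

  commutativeRing : CommutativeRing c ℓ₁
  commutativeRing = record { isCommutativeRing = isCommutativeRing }

  open CommutativeRing commutativeRing public
    using (ring; semiring; commutativeSemiring)

  open import Algebra.Properties.Semiring.Mult semiring
    using () renaming (_×_ to _·_)

  ι : ℕ → Carrier
  ι n = n · 1#

  -- ∣ x - y ∣ < ε
  Within : Carrier → Rel Carrier ℓ₂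
  Within ε x y = x - y < ε × y - x < ε

  Cauchy : (ℕ → Carrier) → Set (c ⊔ ℓ₂)
  Cauchy s = ∀ ε → 0# < ε → ∃[ N ] ∀ m n → N ℕ.≤ m → N ℕ.≤ n → Within ε (s m) (s n)

  infix 4 _⟶_
  _⟶_ : (ℕ → Carrier) → Carrier → Set (c ⊔ ℓ₂)
  s ⟶ x = ∀ ε → 0# < ε → ∃[ N ] ∀ n → N ℕ.≤ n → Within ε (s n) x

-- Classically these axioms determine the field of real numbers up to
-- isomorphism.  The order is not assumed to be decidable, so that constructive
-- real numbers are a model as well.
record RealField c ℓ₁ ℓ₂ : Set (lsuc (c ⊔ ℓ₁ ⊔ ℓ₂)) where
  field
    orderedField : OrderedField c ℓ₁ ℓ₂

  open OrderedField orderedField public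

  field
    archimedean : ∀ x → ∃[ n ] x < ι n
    complete    : ∀ s → Cauchy s → ∃[ x ] s ⟶ x

module OrderProperties {c ℓ₁ ℓ₂} (ℝ : RealField c ℓ₁ ℓ₂) where

  open RealField ℝ
  open IsStrictPartialOrder isStrictPartialOrder public
    using (<-resp-≈; <-respʳ-≈; <-respˡ-≈)
    renaming (irrefl to <-irrefl; trans to <-trans; asym to <-asym)
  open import Algebra.Apartness.Properties.HeytingCommutativeRing
    (HeytingField.heytingCommutativeRing heytingField)
    using (1#0; x-0≈x; invertibleˡ⇒#)
  open import Algebra.Properties.Ring ring
    using (-‿distribˡ-*; -‿distribʳ-*; -‿involutive; -0#≈0#; -‿+-comm)
  open import Algebra.Properties.Semiring.Mult semiring
    using () renaming (_×_ to _·_)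
  open import Algebra.Properties.Semiring.Sum semiring using (sum)

  <-cotrans : ∀ {x y} → x < y → ∀ z → x < z ⊎ z < y
  <-cotrans {x} {y} x<y z with #-cotrans (<⇒# x<y) z
  ... | inj₁ x#z with #⇒<⊎> x#z
  ...   | inj₁ x<z = inj₁ x<z
  ...   | inj₂ z<x = inj₂ (<-trans z<x x<y)
  <-cotrans {x} {y} x<y z | inj₂ z#y with #⇒<⊎> z#y
  ...   | inj₁ z<y = inj₂ z<y
  ...   | inj₂ y<z = inj₁ (<-trans x<y y<z)

  <⇒≤ : _<_ ⇒ _≤_
  <⇒≤ x<y y<x = <-asym x<y y<x

  ≤-trans : Transitive _≤_
  ≤-trans {j = y} x≤y y≤z z<x = [ y≤z , x≤y ]′ (<-cotrans z<x y)

  <-≤-trans : Trans _<_ _≤_ _<_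
  <-≤-trans {k = z} x<y y≤z = [ (λ x<z → x<z) , (λ z<y → ⊥-elim (y≤z z<y)) ]′ (<-cotrans x<y z)

  ≤-<-trans : Trans _≤_ _<_ _<_
  ≤-<-trans {i = x} x≤y y<z = [ (λ y<x → ⊥-elim (x≤y y<x)) , (λ x<z → x<z) ]′ (<-cotrans y<z x)

  ≤-reflexive : _≈_ ⇒ _≤_
  ≤-reflexive x≈y y<x = <-irrefl (sym x≈y) y<x

  ≤-isPreorder : IsPreorder _≈_ _≤_
  ≤-isPreorder = record
    { isEquivalence = isEquivalence ; reflexive = ≤-reflexive ; trans = ≤-trans }

  ≤-refl : ∀ {x} → x ≤ x
  ≤-refl = ≤-reflexive refl

  ≤-antisym : ∀ {x y} → x ≤ y → y ≤ x → x ≈ y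
  ≤-antisym {x} {y} x≤y y≤x = proj₁ (tight x y) ([ y≤x , x≤y ]′ ∘ #⇒<⊎>)

  module ≤-Reasoning where
    open import Relation.Binary.Reasoning.Base.Triple
      ≤-isPreorder <-asym <-trans <-resp-≈ <⇒≤ <-≤-trans ≤-<-trans public

  open ≤-Reasoning

  -x+[x+y]≈y : ∀ x y → - x + (x + y) ≈ y
  -x+[x+y]≈y x y = begin-equality
    - x + (x + y)  ≈⟨ +-assoc (- x) x y ⟨
    - x + x + y    ≈⟨ +-congʳ (-‿inverseˡ x) ⟩
    0# + y         ≈⟨ +-identityˡ y ⟩
    y              ∎

  x+y-x≈y : ∀ x y → x + y - x ≈ y
  x+y-x≈y x y = trans (+-comm (x + y) (- x)) (-x+[x+y]≈y x y)

  +-cancelˡ-< : ∀ x {y z} → x + y < x + z → y < z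
  +-cancelˡ-< x {y} {z} p =
    <-respʳ-≈ (-x+[x+y]≈y x z) (<-respˡ-≈ (-x+[x+y]≈y x y) (+-monoʳ-< (- x) p))

  +-monoʳ-≤ : ∀ x {y z} → y ≤ z → x + y ≤ x + z
  +-monoʳ-≤ x y≤z = y≤z ∘ +-cancelˡ-< x

  +-monoˡ-≤ : ∀ x {y z} → y ≤ z → y + x ≤ z + x
  +-monoˡ-≤ x {y} {z} y≤z = begin
    y + x  ≈⟨ +-comm y x ⟩
    x + y  ≤⟨ +-monoʳ-≤ x y≤z ⟩
    x + z  ≈⟨ +-comm x z ⟩
    z + x  ∎

  +-mono-≤ : ∀ {x y u v} → x ≤ y → u ≤ v → x + u ≤ y + v
  +-mono-≤ x≤y u≤v = ≤-trans (+-monoˡ-≤ _ x≤y) (+-monoʳ-≤ _ u≤v)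

  neg-anti-< : ∀ {x y} → x < y → - y < - x
  neg-anti-< {x} {y} x<y = +-cancelˡ-< (x + y) (begin-strict
    x + y - y      ≈⟨ +-congʳ (+-comm x y) ⟩
    y + x - y      ≈⟨ x+y-x≈y y x ⟩
    x              <⟨ x<y ⟩
    y              ≈⟨ x+y-x≈y x y ⟨
    x + y - x      ∎)

  x<y⇒0<y-x : ∀ {x y} → x < y → 0# < y - x
  x<y⇒0<y-x {x} {y} x<y = begin-strict
    0#     ≈⟨ -‿inverseˡ x ⟨
    - x + x <⟨ +-monoʳ-< (- x) x<y ⟩
    - x + y ≈⟨ +-comm (- x) y ⟩
    y - x  ∎

  *-monoʳ-< : ∀ {x} → 0# < x → ∀ {y z} → y < z → x * y < x * z
  *-monoʳ-< {x} 0<x {y} {z} y<z = begin-strict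
    x * y                ≈⟨ +-identityʳ (x * y) ⟨
    x * y + 0#           <⟨ +-monoʳ-< (x * y) (*-pos 0<x (x<y⇒0<y-x y<z)) ⟩
    x * y + x * (z - y)  ≈⟨ distribˡ x y (z - y) ⟨
    x * (y + (z - y))    ≈⟨ *-congˡ (+-assoc y z (- y)) ⟨
    x * (y + z - y)      ≈⟨ *-congˡ (x+y-x≈y y z) ⟩
    x * z                ∎

  *-monoʳ-≤ : ∀ {x} → 0# ≤ x → ∀ {y z} → y ≤ z → x * y ≤ x * z
  *-monoʳ-≤ {x} 0≤x {y} {z} y≤z xz<xy =
    ¬¬-excluded-middle {A = 0# < x} λ where
      (no  x≤0) → let x≈0 = ≤-antisym x≤0 0≤x in
        <-irrefl (trans (*-congʳ x≈0) (trans (zeroˡ z) (sym (trans (*-congʳ x≈0) (zeroˡ y))))) xz<xy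
      (yes 0<x) → ¬¬-excluded-middle {A = y < z} λ where
        (yes y<z) → <-asym xz<xy (*-monoʳ-< 0<x y<z)
        (no  z≤y) → <-irrefl (*-congˡ (≤-antisym z≤y y≤z)) xz<xy

  *-monoˡ-≤ : ∀ {x} → 0# ≤ x → ∀ {y z} → y ≤ z → y * x ≤ z * x
  *-monoˡ-≤ {x} 0≤x {y} {z} y≤z = begin
    y * x  ≈⟨ *-comm y x ⟩
    x * y  ≤⟨ *-monoʳ-≤ 0≤x y≤z ⟩
    x * z  ≈⟨ *-comm x z ⟩
    z * x  ∎

  *-nonneg : ∀ {x y} → 0# ≤ x → 0# ≤ y → 0# ≤ x * y
  *-nonneg {x} {y} 0≤x 0≤y = begin
    0#      ≈⟨ zeroʳ x ⟨
    x * 0#  ≤⟨ *-monoʳ-≤ 0≤x 0≤y ⟩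
    x * y   ∎

  neg*neg : ∀ x y → - x * - y ≈ x * y
  neg*neg x y = begin-equality
    - x * - y    ≈⟨ -‿distribˡ-* x (- y) ⟨
    - (x * - y)  ≈⟨ -‿cong (-‿distribʳ-* x y) ⟨
    - - (x * y)  ≈⟨ -‿involutive (x * y) ⟩
    x * y        ∎

  0<1 : 0# < 1#
  0<1 with #⇒<⊎> 1#0
  ... | inj₂ 0<1 = 0<1
  ... | inj₁ 1<0 = begin-strict
    0#           <⟨ *-pos 0<-1 0<-1 ⟩
    - 1# * - 1#  ≈⟨ neg*neg 1# 1# ⟩
    1# * 1#      ≈⟨ *-identityˡ 1# ⟩
    1#           ∎
    where
    0<-1 : 0# < - 1#
    0<-1 = <-respˡ-≈ -0#≈0# (neg-anti-< 1<0)

  ι-mono-≤ : ∀ {m n} → m ℕ.≤ n → ι m ≤ ι n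
  ι-mono-≤ {n = zero}  ℕ.z≤n = ≤-refl
  ι-mono-≤ {n = suc n} ℕ.z≤n = begin
    0#        ≈⟨ +-identityʳ 0# ⟨
    0# + 0#   ≤⟨ +-mono-≤ (<⇒≤ 0<1) (ι-mono-≤ {n = n} ℕ.z≤n) ⟩
    1# + ι n  ∎
  ι-mono-≤ (ℕ.s≤s m≤n) = +-monoʳ-≤ 1# (ι-mono-≤ m≤n)

  0≤ι : ∀ n → 0# ≤ ι n
  0≤ι n = ι-mono-≤ {0} {n} ℕ.z≤n

  ι-pos : ∀ n → .{{ℕ.NonZero n}} → 0# < ι n
  ι-pos n@(suc m) = begin-strict
    0#        <⟨ 0<1 ⟩
    1#        ≈⟨ +-identityʳ 1# ⟨
    1# + 0#   ≤⟨ +-monoʳ-≤ 1# (0≤ι m) ⟩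
    1# + ι m  ∎

  inv : ∀ x → 0# < x → Carrier
  inv x 0<x = proj₁ (#⇒invertible (#-sym (<⇒# 0<x)))

  inv-inverseʳ : ∀ x (0<x : 0# < x) → x * inv x 0<x ≈ 1#
  inv-inverseʳ x 0<x = trans (*-congʳ (sym (x-0≈x x)))
    (proj₂ (proj₂ (#⇒invertible (#-sym (<⇒# 0<x)))))

  inv-pos : ∀ x (0<x : 0# < x) → 0# < inv x 0<x
  inv-pos x 0<x with #⇒<⊎> (invertibleˡ⇒# {inv x 0<x} {0#}
    (x , trans (*-congˡ (x-0≈x _)) (inv-inverseʳ x 0<x)))
  ... | inj₂ 0<x⁻¹ = 0<x⁻¹
  ... | inj₁ x⁻¹<0 = ⊥-elim (<-asym 0<1 (begin-strict
    1#              ≈⟨ inv-inverseʳ x 0<x ⟨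
    x * inv x 0<x   <⟨ *-monoʳ-< 0<x x⁻¹<0 ⟩
    x * 0#          ≈⟨ zeroʳ x ⟩
    0#              ∎))

  -- ∣ x ∣ ≤ a
  ∣_∣≤_ : Rel Carrier ℓ₂
  ∣ x ∣≤ a = x ≤ a × - x ≤ a

  ∣∣≤-nonneg : ∀ {x a} → 0# ≤ x → x ≤ a → ∣ x ∣≤ a
  ∣∣≤-nonneg {x} {a} 0≤x x≤a = x≤a , (begin
    - x       ≈⟨ +-identityʳ (- x) ⟨
    - x + 0#  ≤⟨ +-monoʳ-≤ (- x) 0≤x ⟩
    - x + x   ≈⟨ -‿inverseˡ x ⟩
    0#        ≤⟨ 0≤x ⟩
    x         ≤⟨ x≤a ⟩
    a         ∎)

  ∣∣≤-weaken : ∀ {x a b} → ∣ x ∣≤ a → a ≤ b → ∣ x ∣≤ b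
  ∣∣≤-weaken (p , q) a≤b = ≤-trans p a≤b , ≤-trans q a≤b

  ∣∣≤-+ : ∀ {x y a b} → ∣ x ∣≤ a → ∣ y ∣≤ b → ∣ x + y ∣≤ (a + b)
  ∣∣≤-+ {x} {y} (p , q) (p′ , q′) =
    +-mono-≤ p p′ , ≤-trans (≤-reflexive (sym (-‿+-comm x y))) (+-mono-≤ q q′)

  *≤* : ∀ {x y a b} → 0# ≤ a → ∣ x ∣≤ a → ∣ y ∣≤ b → x * y ≤ a * b
  *≤* {x} {y} {a} {b} 0≤a (x≤a , -x≤a) (y≤b , -y≤b) ab<xy =
    ¬¬-excluded-middle {A = y < 0#} λ where
      (no  0≤y) → ≤-trans (*-monoˡ-≤ 0≤y x≤a) (*-monoʳ-≤ 0≤a y≤b) ab<xy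
      (yes y<0) → (λ xy≤ab → xy≤ab ab<xy) (begin
        x * y      ≈⟨ neg*neg x y ⟨
        - x * - y  ≤⟨ *-monoˡ-≤ (<⇒≤ (<-respˡ-≈ -0#≈0# (neg-anti-< y<0))) -x≤a ⟩
        a * - y    ≤⟨ *-monoʳ-≤ 0≤a -y≤b ⟩
        a * b      ∎)

  ∣∣≤-* : ∀ {x y a b} → 0# ≤ a → ∣ x ∣≤ a → ∣ y ∣≤ b → ∣ x * y ∣≤ (a * b)
  ∣∣≤-* {x} {y} 0≤a (x≤a , -x≤a) y≤b =
    *≤* 0≤a (x≤a , -x≤a) y≤b ,
    ≤-trans (≤-reflexive (-‿distribˡ-* x y))
      (*≤* 0≤a (-x≤a , ≤-trans (≤-reflexive (-‿involutive x)) x≤a) y≤b)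

  ∣∣≤-sum : ∀ {n a} (f : Vector Carrier n) → (∀ i → ∣ f i ∣≤ a) → ∣ sum f ∣≤ (n · a)
  ∣∣≤-sum {zero}  f f≤a = ∣∣≤-nonneg ≤-refl ≤-refl
  ∣∣≤-sum {suc n} f f≤a = ∣∣≤-+ (f≤a Fin.zero) (∣∣≤-sum (f ∘ Fin.suc) (f≤a ∘ Fin.suc))

  x-y≤z : ∀ {x y z} → x ≤ y + z → x - y ≤ z
  x-y≤z {x} {y} {z} x≤y+z = begin
    x - y        ≤⟨ +-monoˡ-≤ (- y) x≤y+z ⟩
    y + z - y    ≈⟨ x+y-x≈y y z ⟩
    z            ∎

  y≤y+z : ∀ {y z} → 0# ≤ z → y ≤ y + z
  y≤y+z {y} {z} 0≤z = begin
    y       ≈⟨ +-identityʳ y ⟨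
    y + 0#  ≤⟨ +-monoʳ-≤ y 0≤z ⟩
    y + z   ∎

  ∃-ι-bound : ∀ x → ∃[ n ] ∣ x ∣≤ ι n
  ∃-ι-bound x =
    let m , x<m  = archimedean x
        n , -x<n = archimedean (- x)
    in m ℕ.⊔ n , ≤-trans (<⇒≤ x<m)  (ι-mono-≤ (ℕ.m≤m⊔n m n))
               , ≤-trans (<⇒≤ -x<n) (ι-mono-≤ (ℕ.m≤n⊔m m n))

  ∃-ι-uniform : ∀ {n} (f : Vector Carrier n) → ∃[ b ] ∀ i → ∣ f i ∣≤ ι b
  ∃-ι-uniform {zero}  f = 0 , λ ()
  ∃-ι-uniform {suc n} f =
    let a , f₀≤a = ∃-ι-bound (f Fin.zero)
        b , f≤b  = ∃-ι-uniform (f ∘ Fin.suc)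
    in a ℕ.⊔ b , λ where
      Fin.zero    → ∣∣≤-weaken f₀≤a (ι-mono-≤ (ℕ.m≤m⊔n a b))
      (Fin.suc i) → ∣∣≤-weaken (f≤b i) (ι-mono-≤ (ℕ.m≤n⊔m a b))

d^k≤d^d*k! : ∀ d k → d ℕ.^ k ℕ.≤ d ℕ.^ d ℕ.* k !
d^k≤d^d*k! zero    zero    = ℕ.≤-refl
d^k≤d^d*k! zero    (suc k) = ℕ.z≤n
d^k≤d^d*k! (suc d) zero    = ℕ.≤-trans (ℕ.m^n>0 (suc d) (suc d)) (ℕ.m≤m*n _ 1)
d^k≤d^d*k! d@(suc _) (suc k) with suc k ℕ.≤? d
... | yes k<d = begin
  d ℕ.^ suc k              ≤⟨ ℕ.^-monoʳ-≤ d k<d ⟩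
  d ℕ.^ d                  ≤⟨ ℕ.m≤m*n (d ℕ.^ d) (suc k !) {{suc k ℕ.!≢0}} ⟩
  d ℕ.^ d ℕ.* (suc k !)    ∎
  where open ℕ.≤-Reasoning
... | no  k≮d = begin
  d ℕ.* d ℕ.^ k                  ≤⟨ ℕ.*-mono-≤ (ℕ.≤-trans (ℕ.≮⇒≥ k≮d) (ℕ.n≤1+n k)) (d^k≤d^d*k! d k) ⟩
  suc k ℕ.* (d ℕ.^ d ℕ.* k !)    ≡⟨ x∙yz≈y∙xz (suc k) (d ℕ.^ d) (k !) ⟩
  d ℕ.^ d ℕ.* (suc k !)          ∎
  where
  open ℕ.≤-Reasoning
  open import Algebra.Properties.CommutativeSemigroup ℕ.*-commutativeSemigroup using (x∙yz≈y∙xz)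

^-distribʳ-* : ∀ m n k → (m ℕ.* n) ℕ.^ k ≡ m ℕ.^ k ℕ.* n ℕ.^ k
^-distribʳ-* m n zero    = ≡.refl
^-distribʳ-* m n (suc k) = ≡.trans
  (≡.cong (m ℕ.* n ℕ.*_) (^-distribʳ-* m n k))
  (interchange m n (m ℕ.^ k) (n ℕ.^ k))
  where
  open import Algebra.Properties.CommutativeSemigroup ℕ.*-commutativeSemigroup using (interchange)

2^[1+k]*d^k≤K*k! : ∀ d k →
  2 ℕ.^ suc k ℕ.* d ℕ.^ k ℕ.≤ 2 ℕ.* (2 ℕ.* d) ℕ.^ (2 ℕ.* d) ℕ.* k !
2^[1+k]*d^k≤K*k! d k = begin
  2 ℕ.* 2 ℕ.^ k ℕ.* d ℕ.^ k                  ≡⟨ ℕ.*-assoc 2 (2 ℕ.^ k) (d ℕ.^ k) ⟩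
  2 ℕ.* (2 ℕ.^ k ℕ.* d ℕ.^ k)                ≡⟨ ≡.cong (2 ℕ.*_) (^-distribʳ-* 2 d k) ⟨
  2 ℕ.* (2 ℕ.* d) ℕ.^ k                      ≤⟨ ℕ.*-monoʳ-≤ 2 (d^k≤d^d*k! (2 ℕ.* d) k) ⟩
  2 ℕ.* ((2 ℕ.* d) ℕ.^ (2 ℕ.* d) ℕ.* k !)    ≡⟨ ℕ.*-assoc 2 ((2 ℕ.* d) ℕ.^ (2 ℕ.* d)) (k !) ⟨
  2 ℕ.* (2 ℕ.* d) ℕ.^ (2 ℕ.* d) ℕ.* k !      ∎
  where open ℕ.≤-Reasoning

n≤2^n : ∀ n → n ℕ.≤ 2 ℕ.^ n
n≤2^n zero    = ℕ.z≤n
n≤2^n (suc n) = begin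
  1 ℕ.+ n                     ≤⟨ ℕ.+-mono-≤ (ℕ.m^n>0 2 n) (n≤2^n n) ⟩
  2 ℕ.^ n ℕ.+ 2 ℕ.^ n         ≡⟨ ≡.cong (2 ℕ.^ n ℕ.+_) (ℕ.+-identityʳ (2 ℕ.^ n)) ⟨
  2 ℕ.^ suc n                 ∎
  where open ℕ.≤-Reasoning

module MatrixExponential {c ℓ₁ ℓ₂} (ℝ : RealField c ℓ₁ ℓ₂) where

  open RealField ℝ
  open OrderProperties ℝ
  open ≤-Reasoning
  open import Algebra.Properties.Semiring.Exp semiring using (_^_)
  open import Algebra.Properties.Semiring.Mult semiring
    using (×-assocˡ; ×-congʳ; ×-comm-*; ×1-homo-*) renaming (_×_ to _·_)
  open import Algebra.Properties.Semiring.Sum semiring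
    using (sum; sum-syntax; sum-cong-≋; sum-init-last)
  open import Algebra.Properties.Ring ring using (-‿+-comm)
  open import Algebra.Solver.Ring.NaturalCoefficients.Default commutativeSemiring
    using (solve; _:=_; _:*_; _:+_)

  Matrix : ℕ → Set c
  Matrix n = Fin n → Fin n → Carrier

  infixl 7 _*ₘ_
  infixr 8 _^ₘ_
  infixr 7 _•ₘ_
  infix  8 1/_!

  1ₘ : ∀ {n} → Matrix n
  1ₘ i j = if does (i Fin.≟ j) then 1# else 0#

  _*ₘ_ : ∀ {n} → Matrix n → Matrix n → Matrix n
  _*ₘ_ {n} A B i j = ∑[ k < n ] (A i k * B k j)

  _•ₘ_ : ∀ {n} → Carrier → Matrix n → Matrix n
  (x •ₘ A) i j = x * A i j

  _^ₘ_ : ∀ {n} → Matrix n → ℕ → Matrix n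
  A ^ₘ zero  = 1ₘ
  A ^ₘ suc k = A *ₘ A ^ₘ k

  1/_! : ℕ → Carrier
  1/ k ! = inv (ι (k !)) (ι-pos (k !) {{k ℕ.!≢0}})

  expTerm : ∀ {n} → Matrix n → ℕ → Matrix n
  expTerm A k = 1/ k ! •ₘ A ^ₘ k

  expSum : ∀ {n} → Matrix n → ℕ → Matrix n
  expSum A m i j = ∑[ k < m ] expTerm A (toℕ k) i j

  expSum-suc : ∀ {n} (A : Matrix n) m i j →
               expSum A (suc m) i j ≈ expSum A m i j + expTerm A m i j
  expSum-suc A m i j = trans
    (sum-init-last {m} (λ k → expTerm A (toℕ k) i j))
    (+-cong
      (sum-cong-≋ {m} (λ k → reflexive (≡.cong (λ l → expTerm A l i j) (Fin.toℕ-inject₁ k))))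
      (reflexive (≡.cong (λ l → expTerm A l i j) (Fin.toℕ-fromℕ m))))

  ½ : Carrier
  ½ = inv (ι 2) (ι-pos 2)

  ½^-pos : ∀ k → 0# < ½ ^ k
  ½^-pos zero    = 0<1
  ½^-pos (suc k) = *-pos (inv-pos (ι 2) (ι-pos 2)) (½^-pos k)

  2^*½^ : ∀ k → ι (2 ℕ.^ k) * ½ ^ k ≈ 1#
  2^*½^ zero    = trans (*-identityʳ _) (+-identityʳ 1#)
  2^*½^ (suc k) = begin-equality
    ι (2 ℕ.* 2 ℕ.^ k) * (½ * ½ ^ k)    ≈⟨ *-congʳ (×1-homo-* 2 (2 ℕ.^ k)) ⟩
    ι 2 * ι (2 ℕ.^ k) * (½ * ½ ^ k)    ≈⟨ solve 4 (λ a b c d → a :* b :* (c :* d) := a :* c :* (b :* d)) refl (ι 2) _ ½ _ ⟩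
    ι 2 * ½ * (ι (2 ℕ.^ k) * ½ ^ k)    ≈⟨ *-cong (inv-inverseʳ (ι 2) (ι-pos 2)) (2^*½^ k) ⟩
    1# * 1#                            ≈⟨ *-identityˡ 1# ⟩
    1#                                 ∎

  ½^-double : ∀ x k → x * ½ ^ suc k + x * ½ ^ suc k ≈ x * ½ ^ k
  ½^-double x k = begin-equality
    x * (½ * ½ ^ k) + x * (½ * ½ ^ k)  ≈⟨ distribˡ x _ _ ⟨
    x * (½ * ½ ^ k + ½ * ½ ^ k)        ≈⟨ *-congˡ (distribʳ _ ½ ½) ⟨
    x * ((½ + ½) * ½ ^ k)              ≈⟨ *-congˡ (*-congʳ ½+½) ⟩
    x * (1# * ½ ^ k)                   ≈⟨ *-congˡ (*-identityˡ _) ⟩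
    x * ½ ^ k                          ∎
    where
    ½+½ : ½ + ½ ≈ 1#
    ½+½ = begin-equality
      ½ + ½                    ≈⟨ +-congˡ (+-identityʳ ½) ⟨
      ½ + (½ + 0#)             ≈⟨ ×-congʳ 2 (*-identityʳ ½) ⟨
      2 · (½ * 1#)             ≈⟨ ×-comm-* 2 ½ 1# ⟨
      ½ * ι 2                  ≈⟨ *-comm ½ (ι 2) ⟩
      ι 2 * ½                  ≈⟨ inv-inverseʳ (ι 2) (ι-pos 2) ⟩
      1#                       ∎

  ½^-small : ∀ K ε → 0# < ε → ∃[ N ] ι K * ½ ^ N < ε
  ½^-small K ε 0<ε = let N , p = archimedean (ι K * inv ε 0<ε) in N , (begin-strict
    ι K * ½ ^ N                          ≈⟨ *-congʳ (*-identityʳ (ι K)) ⟨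
    ι K * 1# * ½ ^ N                     ≈⟨ *-congʳ (*-congˡ (inv-inverseʳ ε 0<ε)) ⟨
    ι K * (ε * inv ε 0<ε) * ½ ^ N        ≈⟨ solve 4 (λ a b c d → a :* (b :* c) :* d := b :* d :* (a :* c)) refl (ι K) ε _ _ ⟩
    ε * ½ ^ N * (ι K * inv ε 0<ε)        <⟨ *-monoʳ-< (*-pos 0<ε (½^-pos N)) (<-≤-trans p (ι-mono-≤ (n≤2^n N))) ⟩
    ε * ½ ^ N * ι (2 ℕ.^ N)              ≈⟨ *-assoc ε _ _ ⟩
    ε * (½ ^ N * ι (2 ℕ.^ N))            ≈⟨ *-congˡ (trans (*-comm _ _) (2^*½^ N)) ⟩
    ε * 1#                               ≈⟨ *-identityʳ ε ⟩
    ε                                    ∎)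

  geometric⇒Cauchy : ∀ K (s a : ℕ → Carrier) → (∀ k → s (suc k) ≈ s k + a k) →
                     (∀ k → ∣ a k ∣≤ (ι K * ½ ^ suc k)) → Cauchy s
  geometric⇒Cauchy K s a s-suc a≤w ε 0<ε =
    let N , w<ε = ½^-small K ε 0<ε in
    N , λ m n N≤m N≤n → [ close w<ε N≤m , (λ n≤m → let p , q = close w<ε N≤n n≤m in q , p) ]′ (ℕ.≤-total m n)
    where
    w : ℕ → Carrier
    w k = ι K * ½ ^ k

    0≤w : ∀ k → 0# ≤ w k
    0≤w k = *-nonneg (0≤ι K) (<⇒≤ (½^-pos k))

    w-mono : ∀ {m n} → m ℕ.≤′ n → w n ≤ w m
    w-mono ℕ.≤′-refl = ≤-refl
    w-mono {m} (ℕ.≤′-step {n} m≤n) = begin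
      w (suc n)              ≤⟨ y≤y+z (0≤w (suc n)) ⟩
      w (suc n) + w (suc n)  ≈⟨ ½^-double (ι K) n ⟩
      w n                    ≤⟨ w-mono m≤n ⟩
      w m                    ∎

    step : ∀ x y k → y ≤ w (suc k) → x + y + w (suc k) ≤ x + w k
    step x y k y≤w = begin
      x + y + w (suc k)            ≈⟨ +-assoc x y _ ⟩
      x + (y + w (suc k))          ≤⟨ +-monoʳ-≤ x (+-monoˡ-≤ _ y≤w) ⟩
      x + (w (suc k) + w (suc k))  ≈⟨ +-congˡ (½^-double (ι K) k) ⟩
      x + w k                      ∎

    upper : ∀ {m n} → m ℕ.≤′ n → s n + w n ≤ s m + w m
    upper ℕ.≤′-refl = ≤-refl
    upper {m} (ℕ.≤′-step {n} m≤n) = begin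
      s (suc n) + w (suc n)  ≈⟨ +-congʳ (s-suc n) ⟩
      s n + a n + w (suc n)  ≤⟨ step (s n) (a n) n (proj₁ (a≤w n)) ⟩
      s n + w n              ≤⟨ upper m≤n ⟩
      s m + w m              ∎

    lower : ∀ {m n} → m ℕ.≤′ n → - s n + w n ≤ - s m + w m
    lower ℕ.≤′-refl = ≤-refl
    lower {m} (ℕ.≤′-step {n} m≤n) = begin
      - s (suc n) + w (suc n)      ≈⟨ +-congʳ (trans (-‿cong (s-suc n)) (sym (-‿+-comm (s n) (a n)))) ⟩
      - s n + - a n + w (suc n)    ≤⟨ step (- s n) (- a n) n (proj₂ (a≤w n)) ⟩
      - s n + w n                  ≤⟨ lower m≤n ⟩
      - s m + w m                  ∎

    close : ∀ {N m n} → w N < ε → N ℕ.≤ m → m ℕ.≤ n → Within ε (s m) (s n)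
    close {N} {m} {n} w<ε N≤m m≤n =
      (begin-strict
        s m - s n            ≈⟨ +-comm (s m) _ ⟩
        - s n + s m          ≤⟨ +-monoˡ-≤ (s m) (≤-trans (y≤y+z (0≤w n)) (lower (ℕ.≤⇒≤′ m≤n))) ⟩
        - s m + w m + s m    ≈⟨ +-comm _ (s m) ⟩
        s m + (- s m + w m)  ≈⟨ +-assoc (s m) _ _ ⟨
        s m - s m + w m      ≈⟨ +-congʳ (-‿inverseʳ (s m)) ⟩
        0# + w m             ≈⟨ +-identityˡ (w m) ⟩
        w m                  ≤⟨ w-mono (ℕ.≤⇒≤′ N≤m) ⟩
        w N                  <⟨ w<ε ⟩
        ε                    ∎) ,
      (begin-strict
        s n - s m            ≤⟨ x-y≤z (≤-trans (y≤y+z (0≤w n)) (upper (ℕ.≤⇒≤′ m≤n))) ⟩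
        w m                  ≤⟨ w-mono (ℕ.≤⇒≤′ N≤m) ⟩
        w N                  <⟨ w<ε ⟩
        ε                    ∎)

  ∃-entry-bound : ∀ {n} (A : Matrix n) → ∃[ b ] ∀ i j → ∣ A i j ∣≤ ι b
  ∃-entry-bound A =
    let b , rows≤b = ∃-ι-uniform (λ i → ι (proj₁ (∃-ι-uniform (A i))))
    in b , λ i j → ∣∣≤-weaken (proj₂ (∃-ι-uniform (A i)) j) (proj₁ (rows≤b i))

  ^ₘ-bound : ∀ {n} (A : Matrix n) b → (∀ i j → ∣ A i j ∣≤ ι b) →
             ∀ k i j → ∣ (A ^ₘ k) i j ∣≤ ι ((n ℕ.* b) ℕ.^ k)
  ^ₘ-bound A b A≤b zero i j with does (i Fin.≟ j)
  ... | true  = ∣∣≤-nonneg (<⇒≤ 0<1) (≤-reflexive (sym (+-identityʳ 1#)))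
  ... | false = ∣∣≤-nonneg ≤-refl (0≤ι 1)
  ^ₘ-bound {n} A b A≤b (suc k) i j =
    ∣∣≤-weaken
      (∣∣≤-sum _ (λ l → ∣∣≤-* (0≤ι b) (A≤b i l) (^ₘ-bound A b A≤b k l j)))
      (≤-reflexive (begin-equality
        n · (ι b * ι (d ℕ.^ k))    ≈⟨ ×-congʳ n (×1-homo-* b (d ℕ.^ k)) ⟨
        n · ι (b ℕ.* d ℕ.^ k)      ≈⟨ ×-assocˡ 1# n (b ℕ.* d ℕ.^ k) ⟩
        ι (n ℕ.* (b ℕ.* d ℕ.^ k))  ≡⟨ ≡.cong ι (ℕ.*-assoc n b (d ℕ.^ k)) ⟨
        ι (d ℕ.^ suc k)            ∎))
    where d = n ℕ.* b

  1/k!*d^k : ∀ d k → 1/ k ! * ι (d ℕ.^ k) ≤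
                     ι (2 ℕ.* (2 ℕ.* d) ℕ.^ (2 ℕ.* d)) * ½ ^ suc k
  1/k!*d^k d k = begin
    1/ k ! * ι (d ℕ.^ k)                                    ≈⟨ *-identityʳ _ ⟨
    1/ k ! * ι (d ℕ.^ k) * 1#                               ≈⟨ *-congˡ (2^*½^ (suc k)) ⟨
    1/ k ! * ι (d ℕ.^ k) * (ι (2 ℕ.^ suc k) * ½ ^ suc k)    ≈⟨ solve 4 (λ x y z h → x :* y :* (z :* h) := x :* h :* (z :* y)) refl (1/ k !) _ _ _ ⟩
    1/ k ! * ½ ^ suc k * (ι (2 ℕ.^ suc k) * ι (d ℕ.^ k))    ≈⟨ *-congˡ (×1-homo-* (2 ℕ.^ suc k) (d ℕ.^ k)) ⟨
    1/ k ! * ½ ^ suc k * ι (2 ℕ.^ suc k ℕ.* d ℕ.^ k)        ≤⟨ *-monoʳ-≤ (<⇒≤ (*-pos (inv-pos _ (ι-pos (k !) {{k ℕ.!≢0}})) (½^-pos (suc k)))) (ι-mono-≤ (2^[1+k]*d^k≤K*k! d k)) ⟩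
    1/ k ! * ½ ^ suc k * ι (K ℕ.* k !)                      ≈⟨ *-congˡ (×1-homo-* K (k !)) ⟩
    1/ k ! * ½ ^ suc k * (ι K * ι (k !))                    ≈⟨ solve 4 (λ x h y z → x :* h :* (y :* z) := y :* h :* (z :* x)) refl (1/ k !) _ (ι K) _ ⟩
    ι K * ½ ^ suc k * (ι (k !) * 1/ k !)                    ≈⟨ *-congˡ (inv-inverseʳ _ (ι-pos (k !) {{k ℕ.!≢0}})) ⟩
    ι K * ½ ^ suc k * 1#                                    ≈⟨ *-identityʳ _ ⟩
    ι K * ½ ^ suc k                                         ∎
    where
    K = 2 ℕ.* (2 ℕ.* d) ℕ.^ (2 ℕ.* d)

  expSum-cauchy : ∀ {n} (A : Matrix n) i j → Cauchy (λ m → expSum A m i j)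
  expSum-cauchy {n} A i j =
    let b , A≤b = ∃-entry-bound A
        d       = n ℕ.* b
    in geometric⇒Cauchy (2 ℕ.* (2 ℕ.* d) ℕ.^ (2 ℕ.* d)) _
         (λ k → expTerm A k i j) (λ k → expSum-suc A k i j)
         (λ k → ∣∣≤-weaken
           (∣∣≤-* (1/!-nonneg k) (∣∣≤-nonneg (1/!-nonneg k) ≤-refl) (^ₘ-bound A b A≤b k i j))
           (1/k!*d^k d k))
    where
    1/!-nonneg : ∀ k → 0# ≤ 1/ k !
    1/!-nonneg k = <⇒≤ (inv-pos _ (ι-pos (k !) {{k ℕ.!≢0}}))

  abstract
    exp-converges : ∀ {n} (A : Matrix n) i j → ∃[ x ] (λ m → expSum A m i j) ⟶ x
    exp-converges A i j = complete _ (expSum-cauchy A i j)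

  exp : ∀ {n} → Matrix n → Matrix n
  exp A i j = proj₁ (exp-converges A i j)

record Graph (n : ℕ) (ℓ : Level) : Set (lsuc ℓ) where
  field
    Adj    : Rel (Fin n) ℓ
    sym    : Symmetric Adj
    irrefl : Irreflexive _≡_ Adj

open Graph public using (Adj)

infix 4 _≈ᴳ_
_≈ᴳ_ : ∀ {n ℓ} → Rel (Graph n ℓ) ℓ
G ≈ᴳ H = ∀ i j → Adj G i j ⇔ Adj H i j

module ZeroForcing {n ℓ} (G : Graph n ℓ) where

  data _Forces_ (B : Subset n) : Subset n → Set ℓ where
    force : ∀ {i j} → i ∈ B → j ∉ B → Adj G i j →
            (∀ k → Adj G i k → k ∉ B → k ≡ j) →
            B Forces (B ∪ ⁅ j ⁆)

  IsZeroForcingSet : Subset n → Set ℓ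
  IsZeroForcingSet Z = Star _Forces_ Z ⊤

open ZeroForcing public using (IsZeroForcingSet)

module MarkovChain {c ℓ₁ ℓ₂} (ℝ : RealField c ℓ₁ ℓ₂) where

  open RealField ℝ
  open MatrixExponential ℝ public using (Matrix; _•ₘ_; exp)
  open import Algebra.Properties.Semiring.Sum semiring using (sum-syntax)

  record IsTransitionRateMatrix {n} (Q : Matrix n) : Set (c ⊔ ℓ₁ ⊔ ℓ₂) where
    field
      offDiagonal-nonneg : ∀ i j → i ≢ j → 0# ≤ Q i j
      diagonal           : ∀ i → Q i i ≈ - (∑[ j < n ] (if does (i Fin.≟ j) then 0# else Q i j))

  transitionMatrix : ∀ {n} → Matrix n → Carrier → Matrix n
  transitionMatrix Q t = exp (t •ₘ Q)

  -- An entry is nonzero when it is not equal to 0#; it need not be apart from it.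
  CombinatoriallySymmetric : ∀ {n} → Matrix n → Set ℓ₁
  CombinatoriallySymmetric M = ∀ i j → ¬ (M i j ≈ 0#) → ¬ (M j i ≈ 0#)

  𝒢 : ∀ {n} → Matrix n → Graph n ℓ₁
  𝒢 M = record
    { Adj    = λ i j → Edge i j ⊎ Edge j i
    ; sym    = swap
    ; irrefl = λ { ≡.refl → [ Fin.<-irrefl ≡.refl ∘ proj₁ , Fin.<-irrefl ≡.refl ∘ proj₁ ]′ }
    }
    where
    Edge : Rel (Fin _) ℓ₁
    Edge i j = i Fin.< j × ¬ (M i j ≈ 0#)

{-# OPTIONS --safe #-}
-- For i, j ∈ Z both exponentials are power series in t, so comparing coefficients
-- yields (Q′ᵏ)ᵢⱼ = (Qᵏ)ᵢⱼ for all k.  This agreement of all powers spreads along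
-- forces: if i ∈ B forces j, the i-th rows of Q and Q′ vanish outside B ∪ {j}, and
-- since the rows sum to zero, agreement on B yields Q′ᵢⱼ = Qᵢⱼ.  In the expansion of
-- (Qᵏ⁺¹)ᵢₗ along row i the term Qᵢⱼ(Qᵏ)ⱼₗ is then the only unknown, and Qᵢⱼ ≠ 0 can
-- be cancelled.  The same expansion along column i gives the entries (Qᵏ)ₗⱼ.  Once
-- all states are blue, k = 1 is the claim.
module Submission where

open import Defs
open import Algebra.Bundles using (CommutativeRing)
open import Data.Bool.Base using (if_then_else_)
open import Data.Fin.Base as Fin using (Fin; toℕ; punchIn)
import Data.Fin.Properties as Fin
open import Data.Fin.Subset using (Subset; _∈_; _∉_; _∪_; ⁅_⁆)
open import Data.Fin.Subset.Properties using (_∈?_; ∈⊤; x∈p∪q⁻; x∈⁅y⁆⇒x≡y)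
open import Data.Nat.Base as ℕ using (ℕ; zero; suc; _!)
import Data.Nat.Properties as ℕ
open import Data.Product.Base using (_×_; _,_; ∃-syntax; proj₁; proj₂)
open import Data.Sum.Base using (inj₁; inj₂)
open import Data.Vec.Functional using (Vector; removeAt)
open import Function.Base using (_∘_)
open import Function.Bundles using (Equivalence)
open import Relation.Binary.Construct.Closure.ReflexiveTransitive as Star using (_◅_)
open import Relation.Binary.Definitions using (tri<; tri≈; tri>)
open import Relation.Binary.PropositionalEquality.Core as ≡ using (_≡_; _≢_)
open import Relation.Nullary.Decidable using (yes; no; does; dec-true; dec-false)
open import Relation.Nullary.Negation using (¬_; contradiction)

-- Identity theorem for power series with bounded coefficients

module PowerSeries {c ℓ₁ ℓ₂} (ℝ : RealField c ℓ₁ ℓ₂) where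

  open RealField ℝ
  open OrderProperties ℝ
  open ≤-Reasoning
  open MatrixExponential ℝ using (½; ½^-pos; ½^-small; ½^-double)
  open import Algebra.Properties.Ring ring
    using (-‿distribʳ-*; -‿involutive; -‿+-comm; [y-z]x≈yx-zx; ⁻¹-anti-homo‿-)
  open import Algebra.Properties.CommutativeSemigroup
    (CommutativeRing.+-commutativeSemigroup commutativeRing)
    using () renaming (interchange to +-interchange)
  open import Algebra.Properties.CommutativeSemigroup
    (CommutativeRing.*-commutativeSemigroup commutativeRing)
    using (x∙yz≈y∙xz)
  open import Algebra.Properties.Semiring.Exp semiring using (_^_)
  open import Algebra.Properties.Semiring.Sum semiring
    using (sum-syntax; sum-cong-≋; *-distribˡ-sum)

  ∣∣≤-resp-≈ : ∀ {x y a} → x ≈ y → ∣ x ∣≤ a → ∣ y ∣≤ a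
  ∣∣≤-resp-≈ x≈y (p , q) =
    ≤-trans (≤-reflexive (sym x≈y)) p , ≤-trans (≤-reflexive (-‿cong (sym x≈y))) q

  ∣∣≤-neg : ∀ {x a} → ∣ x ∣≤ a → ∣ - x ∣≤ a
  ∣∣≤-neg {x} (p , q) = q , ≤-trans (≤-reflexive (-‿involutive x)) p

  *-cancelˡ-≤ : ∀ {t x y} → 0# < t → t * x ≤ t * y → x ≤ y
  *-cancelˡ-≤ 0<t tx≤ty y<x = tx≤ty (*-monoʳ-< 0<t y<x)

  0<½ : 0# < ½
  0<½ = <-respʳ-≈ (*-identityʳ ½) (½^-pos 1)

  ½x+½x≈x : ∀ x → ½ * x + ½ * x ≈ x
  ½x+½x≈x x = begin-equality
    ½ * x + ½ * x            ≈⟨ +-cong eq eq ⟨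
    x * ½ ^ 1 + x * ½ ^ 1    ≈⟨ ½^-double x 0 ⟩
    x * 1#                   ≈⟨ *-identityʳ x ⟩
    x                        ∎
    where
    eq : x * ½ ^ 1 ≈ ½ * x
    eq = trans (*-congˡ (*-identityʳ ½)) (*-comm x ½)

  ½<1 : ½ < 1#
  ½<1 = begin-strict
    ½                ≈⟨ +-identityʳ ½ ⟨
    ½ + 0#           <⟨ +-monoʳ-< ½ 0<½ ⟩
    ½ + ½            ≈⟨ +-cong (*-identityʳ ½) (*-identityʳ ½) ⟨
    ½ * 1# + ½ * 1#  ≈⟨ ½x+½x≈x 1# ⟩
    1#               ∎

  ½^≤1 : ∀ k → ½ ^ k ≤ 1#
  ½^≤1 zero    = ≤-refl
  ½^≤1 (suc k) = begin
    ½ * ½ ^ k  ≤⟨ *-monoʳ-≤ (<⇒≤ 0<½) (½^≤1 k) ⟩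
    ½ * 1#     ≈⟨ *-identityʳ ½ ⟩
    ½          ≤⟨ <⇒≤ ½<1 ⟩
    1#         ∎

  -- The order `_≤_` is a negation, so `0# < x` may be assumed; the bound `ε = ½ * x` then
  -- contradicts it.
  ≤-arbitrary⇒≤0 : ∀ {x} → (∀ ε → 0# < ε → x ≤ ε) → x ≤ 0#
  ≤-arbitrary⇒≤0 {x} x≤ε 0<x = x≤ε (½ * x) 0<½x (begin-strict
    ½ * x          ≈⟨ +-identityʳ _ ⟨
    ½ * x + 0#     <⟨ +-monoʳ-< _ 0<½x ⟩
    ½ * x + ½ * x  ≈⟨ ½x+½x≈x x ⟩
    x              ∎)
    where
    0<½x : 0# < ½ * x
    0<½x = *-pos 0<½ 0<x

  ∣∣≤-arbitrary⇒≈0 : ∀ {x} → (∀ ε → 0# < ε → ∣ x ∣≤ ε) → x ≈ 0#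
  ∣∣≤-arbitrary⇒≈0 {x} ∣x∣≤ε = ≤-antisym
    (≤-arbitrary⇒≤0 (λ ε 0<ε → proj₁ (∣x∣≤ε ε 0<ε)))
    (begin
      0#       ≈⟨ -‿inverseʳ x ⟨
      x - x    ≤⟨ +-monoʳ-≤ x (≤-arbitrary⇒≤0 (λ ε 0<ε → proj₂ (∣x∣≤ε ε 0<ε))) ⟩
      x + 0#   ≈⟨ +-identityʳ x ⟩
      x        ∎)

  -- Null sequences are phrased with the weak bound `∣_∣≤_`, because sums and products of such
  -- bounds are available without deciding signs.
  Vanishes : (ℕ → Carrier) → Set _
  Vanishes s = ∀ ε → 0# < ε → ∃[ N ] ∀ n → N ℕ.≤ n → ∣ s n ∣≤ ε

  Vanishes-resp-≈ : ∀ {s s′} → (∀ n → s n ≈ s′ n) → Vanishes s → Vanishes s′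
  Vanishes-resp-≈ s≈s′ s→0 ε 0<ε =
    let N , s≤ε = s→0 ε 0<ε in N , λ n N≤n → ∣∣≤-resp-≈ (s≈s′ n) (s≤ε n N≤n)

  Within⇒∣∣≤ : ∀ {δ x y} → Within δ x y → ∣ x - y ∣≤ δ
  Within⇒∣∣≤ {δ} {x} {y} (p , q) =
    <⇒≤ p , ≤-trans (≤-reflexive (⁻¹-anti-homo‿- x y)) (<⇒≤ q)

  ⟶⇒difference-vanishes : ∀ {s s′ x y} → s ⟶ x → s′ ⟶ y → x ≈ y → Vanishes (λ n → s n - s′ n)
  ⟶⇒difference-vanishes {s} {s′} {x} {y} s→x s′→y x≈y ε 0<ε =
    let M , s≈x  = s→x  (½ * ε) (*-pos 0<½ 0<ε)
        N , s′≈y = s′→y (½ * ε) (*-pos 0<½ 0<ε)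
    in M ℕ.⊔ N , λ n M⊔N≤n →
      ∣∣≤-weaken
        (∣∣≤-resp-≈ (telescope (s n) (s′ n)) (∣∣≤-+
          (Within⇒∣∣≤ (s≈x n (ℕ.m⊔n≤o⇒m≤o M N M⊔N≤n)))
          (∣∣≤-neg (Within⇒∣∣≤ (s′≈y n (ℕ.m⊔n≤o⇒n≤o M N M⊔N≤n))))))
        (≤-reflexive (½x+½x≈x ε))
    where
    telescope : ∀ u v → (u - x) + - (v - y) ≈ u - v
    telescope u v = begin-equality
      (u - x) + - (v - y)      ≈⟨ +-congˡ (⁻¹-anti-homo‿- v y) ⟩
      (u - x) + (y - v)        ≈⟨ +-congˡ (+-congʳ (sym x≈y)) ⟩
      (u - x) + (x - v)        ≈⟨ +-assoc u (- x) (x - v) ⟩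
      u + (- x + (x - v))      ≈⟨ +-congˡ (-x+[x+y]≈y x (- v)) ⟩
      u - v                    ∎

  partialSum : (ℕ → Carrier) → Carrier → ℕ → Carrier
  partialSum a t m = ∑[ k < m ] (a (toℕ k) * t ^ toℕ k)

  -- The Horner step: the tail is `t` times the power series of the shifted sequence, so inductions
  -- can pass from `a` to `a ∘ suc`.
  partialSum-suc : ∀ a t m → partialSum a t (suc m) ≈ a 0 + t * partialSum (a ∘ suc) t m
  partialSum-suc a t m = +-cong (*-identityʳ (a 0)) (trans
    (sum-cong-≋ {m} (λ k → x∙yz≈y∙xz (a (suc (toℕ k))) t (t ^ toℕ k)))
    (sym (*-distribˡ-sum {m} t (λ k → a (suc (toℕ k)) * t ^ toℕ k))))

  partialSum-sub : ∀ a b t m →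
    partialSum (λ k → a k - b k) t m ≈ partialSum a t m - partialSum b t m
  partialSum-sub a b t m = go m (λ k → a k * t ^ k) (λ k → b k * t ^ k)
    (λ k → (a k - b k) * t ^ k) (λ k → [y-z]x≈yx-zx (t ^ k) (a k) (b k))
    where
    -- Arbitrary sequences are needed here, since the induction peels off the first summand and
    -- continues with shifted sequences.
    go : ∀ m (f g h : ℕ → Carrier) → (∀ k → h k ≈ f k - g k) →
         ∑[ k < m ] h (toℕ k) ≈ ∑[ k < m ] f (toℕ k) - ∑[ k < m ] g (toℕ k)
    go zero    f g h h≈f-g = sym (-‿inverseʳ 0#)
    go (suc m) f g h h≈f-g = trans
      (+-cong (h≈f-g 0) (go m (f ∘ suc) (g ∘ suc) (h ∘ suc) (h≈f-g ∘ suc)))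
      (trans (+-interchange (f 0) (- g 0) _ _) (+-congˡ (-‿+-comm (g 0) _)))

  -- The bound is the geometric series with ratio ½. It is reproduced by the Horner step, since w +
  -- ½(w + w) = w + w, and is therefore uniform in the number of terms.
  partialSum-bound : ∀ {w t} → 0# ≤ w → 0# ≤ t → t ≤ ½ → ∀ a → (∀ k → ∣ a k ∣≤ w) →
                     ∀ m → ∣ partialSum a t m ∣≤ (w + w)
  partialSum-bound 0≤w 0≤t t≤½ a a≤w zero =
    ∣∣≤-nonneg ≤-refl (≤-trans (≤-reflexive (sym (+-identityʳ 0#))) (+-mono-≤ 0≤w 0≤w))
  partialSum-bound {w} {t} 0≤w 0≤t t≤½ a a≤w (suc m) =
    ∣∣≤-resp-≈ (sym (partialSum-suc a t m)) (∣∣≤-+ (a≤w 0) (∣∣≤-weaken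
      (∣∣≤-* (<⇒≤ 0<½) (∣∣≤-nonneg 0≤t t≤½)
        (partialSum-bound 0≤w 0≤t t≤½ (a ∘ suc) (a≤w ∘ suc) m))
      (≤-reflexive (trans (distribˡ ½ w w) (½x+½x≈x w)))))

  -- The range of `t` is positive so that `t` can be cancelled when the series is shifted, and ends
  -- at ½ so that `partialSum-bound` applies.
  VanishesNear0 : (ℕ → Carrier) → Set _
  VanishesNear0 a = ∀ t → 0# < t → t ≤ ½ → Vanishes (partialSum a t)

  -- The constant term is a partial sum minus `t` times a tail. The tail is bounded independently of
  -- its length, so first `t` is chosen to make the second part at most ε/2, and then, for this
  -- fixed `t`, the length to make the first part at most ε/2.
  constantTerm≈0 : ∀ a W → (∀ k → ∣ a k ∣≤ ι W) → VanishesNear0 a → a 0 ≈ 0#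
  constantTerm≈0 a W a≤W a→0 = ∣∣≤-arbitrary⇒≈0 λ ε 0<ε →
    let δ       = ½ * ε
        0<δ     = *-pos 0<½ 0<ε
        N , w<δ = ½^-small W δ 0<δ
        -- The extra factor ½ absorbs the bound 2W on the tail, leaving `ι W * ½ ^ N`, and also
        -- ensures `t ≤ ½`.
        t       = ½ ^ suc N
        0<t     = ½^-pos (suc N)
        t≤½     = ≤-trans (*-monoʳ-≤ (<⇒≤ 0<½) (½^≤1 N)) (≤-reflexive (*-identityʳ ½))
        M , s≤δ = a→0 t 0<t t≤½ δ 0<δ
        rest    = t * partialSum (a ∘ suc) t M
        rest≤δ  : ∣ rest ∣≤ δ
        rest≤δ  = ∣∣≤-weaken
          (∣∣≤-* (<⇒≤ 0<t) (∣∣≤-nonneg (<⇒≤ 0<t) ≤-refl)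
            (partialSum-bound (0≤ι W) (<⇒≤ 0<t) t≤½ (a ∘ suc) (a≤W ∘ suc) M))
          (begin
            t * (ι W + ι W)      ≈⟨ *-comm t _ ⟩
            (ι W + ι W) * t      ≈⟨ distribʳ t (ι W) (ι W) ⟩
            ι W * t + ι W * t    ≈⟨ ½^-double (ι W) N ⟩
            ι W * ½ ^ N          ≤⟨ <⇒≤ w<δ ⟩
            δ                    ∎)
    in ∣∣≤-weaken
      (∣∣≤-resp-≈
        (begin-equality
          partialSum a t (suc M) - rest   ≈⟨ +-congʳ (partialSum-suc a t M) ⟩
          a 0 + rest - rest               ≈⟨ +-assoc (a 0) rest (- rest) ⟩
          a 0 + (rest - rest)             ≈⟨ +-congˡ (-‿inverseʳ rest) ⟩
          a 0 + 0#                        ≈⟨ +-identityʳ (a 0) ⟩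
          a 0                             ∎)
        (∣∣≤-+ (s≤δ (suc M) (ℕ.n≤1+n M)) (∣∣≤-neg rest≤δ)))
      (≤-reflexive (½x+½x≈x ε))

  -- Without its constant term the series is `t` times the shifted one, so accuracy `t * ε` for the
  -- former gives accuracy `ε` for the latter.
  VanishesNear0-shift : ∀ a → a 0 ≈ 0# → VanishesNear0 a → VanishesNear0 (a ∘ suc)
  VanishesNear0-shift a a₀≈0 a→0 t 0<t t≤½ ε 0<ε =
    let N , s≤tε = a→0 t 0<t t≤½ (t * ε) (*-pos 0<t 0<ε)
    in N , λ n N≤n →
      let p , q = ∣∣≤-resp-≈
            (trans (partialSum-suc a t n) (trans (+-congʳ a₀≈0) (+-identityˡ _)))
            (s≤tε (suc n) (ℕ.m≤n⇒m≤1+n N≤n))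
      in *-cancelˡ-≤ 0<t p
       , *-cancelˡ-≤ 0<t (≤-trans (≤-reflexive (sym (-‿distribʳ-* t _))) q)

  -- Constant terms are stripped one after the other; the bound `W` is inherited by every shifted
  -- sequence.
  coefficients≈0 : ∀ a W → (∀ k → ∣ a k ∣≤ ι W) → VanishesNear0 a → ∀ k → a k ≈ 0#
  coefficients≈0 a W a≤W a→0 zero    = constantTerm≈0 a W a≤W a→0
  coefficients≈0 a W a≤W a→0 (suc k) = coefficients≈0 (a ∘ suc) W (a≤W ∘ suc)
    (VanishesNear0-shift a (constantTerm≈0 a W a≤W a→0) a→0) k

-- Matrix powers as coefficients of the matrix exponential

module MatrixPowers {c ℓ₁ ℓ₂} (ℝ : RealField c ℓ₁ ℓ₂) where

  open RealField ℝ
  open OrderProperties ℝ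
  open ≤-Reasoning
  open MatrixExponential ℝ
  open PowerSeries ℝ
  open import Algebra.Properties.Ring ring using (+-cancelʳ; x∙y⁻¹≈ε⇒x≈y)
  open import Algebra.Properties.Semiring.Exp semiring using (_^_)
  open import Algebra.Properties.Semiring.Mult semiring using (×1-homo-*; ×-homo-+)
  open import Algebra.Properties.Semiring.Sum semiring
  open import Algebra.Solver.Ring.NaturalCoefficients.Default commutativeSemiring
    using (solve; _:=_; _:*_)

  sum-onlyAt : ∀ {n} (f : Vector Carrier n) j → (∀ l → l ≢ j → f l ≈ 0#) → sum f ≈ f j
  sum-onlyAt {suc n} f j f≈0 = begin-equality
    sum f                      ≈⟨ sum-remove f ⟩
    f j + sum (removeAt f j)   ≈⟨ +-congˡ (sum-cong-≋ (λ l → f≈0 (punchIn j l) (Fin.punchInᵢ≢i j l))) ⟩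
    f j + ∑[ l < n ] 0#        ≈⟨ +-congˡ (sum-replicate-zero n) ⟩
    f j + 0#                   ≈⟨ +-identityʳ (f j) ⟩
    f j                        ∎

  sum-cancelAt : ∀ {n} {f g : Vector Carrier n} j → (∀ l → l ≢ j → f l ≈ g l) →
                 sum f ≈ sum g → f j ≈ g j
  sum-cancelAt {suc n} {f} {g} j f≈g Σf≈Σg = +-cancelʳ (sum (removeAt g j)) (f j) (g j) (begin-equality
    f j + sum (removeAt g j)   ≈⟨ +-congˡ (sum-cong-≋ (λ l → f≈g (punchIn j l) (Fin.punchInᵢ≢i j l))) ⟨
    f j + sum (removeAt f j)   ≈⟨ sum-remove f ⟨
    sum f                      ≈⟨ Σf≈Σg ⟩
    sum g                      ≈⟨ sum-remove g ⟩
    g j + sum (removeAt g j)   ∎)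

  1ₘ-diagonal : ∀ {n} (i : Fin n) → 1ₘ i i ≈ 1#
  1ₘ-diagonal i = reflexive (≡.cong (λ b → if b then 1# else 0#) (dec-true (i Fin.≟ i) ≡.refl))

  1ₘ-offDiagonal : ∀ {n} {i j : Fin n} → i ≢ j → 1ₘ i j ≈ 0#
  1ₘ-offDiagonal {i = i} {j} i≢j =
    reflexive (≡.cong (λ b → if b then 1# else 0#) (dec-false (i Fin.≟ j) i≢j))

  *ₘ-identityʳ : ∀ {n} (A : Matrix n) i j → (A *ₘ 1ₘ) i j ≈ A i j
  *ₘ-identityʳ A i j = trans
    (sum-onlyAt _ j (λ l l≢j → trans (*-congˡ (1ₘ-offDiagonal l≢j)) (zeroʳ _)))
    (trans (*-congˡ (1ₘ-diagonal j)) (*-identityʳ _))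

  *ₘ-identityˡ : ∀ {n} (A : Matrix n) i j → (1ₘ *ₘ A) i j ≈ A i j
  *ₘ-identityˡ A i j = trans
    (sum-onlyAt _ i (λ l l≢i → trans (*-congʳ (1ₘ-offDiagonal (l≢i ∘ ≡.sym))) (zeroˡ _)))
    (trans (*-congʳ (1ₘ-diagonal i)) (*-identityˡ _))

  *ₘ-assoc : ∀ {n} (A B C : Matrix n) i j → ((A *ₘ B) *ₘ C) i j ≈ (A *ₘ (B *ₘ C)) i j
  *ₘ-assoc {n} A B C i j = begin-equality
    ∑[ l < n ] ((∑[ k < n ] (A i k * B k l)) * C l j)
      ≈⟨ sum-cong-≋ (λ l → *-distribʳ-sum (C l j) (λ k → A i k * B k l)) ⟩
    ∑[ l < n ] ∑[ k < n ] (A i k * B k l * C l j)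
      ≈⟨ ∑-comm (λ l k → A i k * B k l * C l j) ⟩
    ∑[ k < n ] ∑[ l < n ] (A i k * B k l * C l j)
      ≈⟨ sum-cong-≋ (λ k → sum-cong-≋ (λ l → *-assoc (A i k) (B k l) (C l j))) ⟩
    ∑[ k < n ] ∑[ l < n ] (A i k * (B k l * C l j))
      ≈⟨ sum-cong-≋ (λ k → *-distribˡ-sum (A i k) (λ l → B k l * C l j)) ⟨
    ∑[ k < n ] (A i k * ∑[ l < n ] (B k l * C l j))
      ∎

  -- Powers are defined by multiplication from the left, which expands along rows; this form gives
  -- the expansion along columns.
  ^ₘ-sucʳ : ∀ {n} (A : Matrix n) k i j → (A ^ₘ suc k) i j ≈ (A ^ₘ k *ₘ A) i j
  ^ₘ-sucʳ A zero    i j = trans (*ₘ-identityʳ A i j) (sym (*ₘ-identityˡ A i j))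
  ^ₘ-sucʳ A (suc k) i j = trans
    (sum-cong-≋ (λ l → *-congˡ (^ₘ-sucʳ A k l j)))
    (sym (*ₘ-assoc A (A ^ₘ k) A i j))

  •ₘ-^ₘ : ∀ {n} t (A : Matrix n) k i j → ((t •ₘ A) ^ₘ k) i j ≈ t ^ k * (A ^ₘ k) i j
  •ₘ-^ₘ t A zero    i j = sym (*-identityˡ _)
  •ₘ-^ₘ t A (suc k) i j = trans
    (sum-cong-≋ (λ l → trans (*-congˡ (•ₘ-^ₘ t A k l j))
      (solve 4 (λ t a s b → t :* a :* (s :* b) := t :* s :* (a :* b)) refl t (A i l) (t ^ k) _)))
    (sym (*-distribˡ-sum (t * t ^ k) (λ l → A i l * (A ^ₘ k) l j)))

  0<1/_! : ∀ k → 0# < 1/ k !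
  0<1/ k ! = inv-pos _ (ι-pos (k !) {{k ℕ.!≢0}})

  k!*1/k! : ∀ k → ι (k !) * 1/ k ! ≈ 1#
  k!*1/k! k = inv-inverseʳ _ (ι-pos (k !) {{k ℕ.!≢0}})

  expTerm-injective : ∀ {n} {A B : Matrix n} k {i j} → expTerm A k i j ≈ expTerm B k i j →
                      (A ^ₘ k) i j ≈ (B ^ₘ k) i j
  expTerm-injective {A = A} {B} k {i} {j} eq = begin-equality
    (A ^ₘ k) i j                  ≈⟨ cancel A ⟨
    ι (k !) * expTerm A k i j     ≈⟨ *-congˡ eq ⟩
    ι (k !) * expTerm B k i j     ≈⟨ cancel B ⟩
    (B ^ₘ k) i j                  ∎
    where
    cancel : ∀ M → ι (k !) * expTerm M k i j ≈ (M ^ₘ k) i j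
    cancel M = trans (sym (*-assoc _ _ _)) (trans (*-congʳ (k!*1/k! k)) (*-identityˡ _))

  -- Entries of the k-th power are at most d^k, and d^k ≤ d^d k!, so the single constant d^d serves
  -- all k, as `coefficients≈0` requires.
  expTerm-bound : ∀ {n} (A : Matrix n) → ∃[ W ] ∀ k i j → ∣ expTerm A k i j ∣≤ ι W
  expTerm-bound {n} A =
    let b , A≤b = ∃-entry-bound A
        d       = n ℕ.* b
    in d ℕ.^ d , λ k i j → ∣∣≤-weaken
      (∣∣≤-* (<⇒≤ 0<1/ k !) (∣∣≤-nonneg (<⇒≤ 0<1/ k !) ≤-refl) (^ₘ-bound A b A≤b k i j))
      (begin
        1/ k ! * ι (d ℕ.^ k)               ≤⟨ *-monoʳ-≤ (<⇒≤ 0<1/ k !) (ι-mono-≤ (d^k≤d^d*k! d k)) ⟩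
        1/ k ! * ι (d ℕ.^ d ℕ.* k !)       ≈⟨ *-congˡ (×1-homo-* (d ℕ.^ d) (k !)) ⟩
        1/ k ! * (ι (d ℕ.^ d) * ι (k !))   ≈⟨ solve 3 (λ x y z → x :* (y :* z) := z :* x :* y) refl (1/ k !) _ _ ⟩
        ι (k !) * 1/ k ! * ι (d ℕ.^ d)     ≈⟨ *-congʳ (k!*1/k! k) ⟩
        1# * ι (d ℕ.^ d)                   ≈⟨ *-identityˡ _ ⟩
        ι (d ℕ.^ d)                        ∎)

  expSum-partialSum : ∀ {n} t (A : Matrix n) i j m →
    expSum (t •ₘ A) m i j ≈ partialSum (λ k → expTerm A k i j) t m
  expSum-partialSum t A i j m = sum-cong-≋ {m} (λ k → trans
    (*-congˡ (•ₘ-^ₘ t A (toℕ k) i j))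
    (solve 3 (λ x y z → x :* (y :* z) := x :* z :* y) refl _ _ _))

  -- The termwise difference of the two exponential series is a power series in `t` with
  -- coefficients bounded by `V ℕ.+ W`. Its partial sums tend to zero for each positive `t`, so its
  -- coefficients vanish, and the factor 1/k! cancels.
  exp-determines-powers : ∀ {n} (A B : Matrix n) i j →
    (∀ t → 0# ≤ t → exp (t •ₘ A) i j ≈ exp (t •ₘ B) i j) →
    ∀ k → (A ^ₘ k) i j ≈ (B ^ₘ k) i j
  exp-determines-powers A B i j expA≈expB k =
    let V , A≤V = expTerm-bound A
        W , B≤W = expTerm-bound B
    in expTerm-injective {A = A} {B} k (x∙y⁻¹≈ε⇒x≈y _ _ (coefficients≈0
      (λ k → expTerm A k i j - expTerm B k i j)
      (V ℕ.+ W)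
      (λ k → ∣∣≤-weaken (∣∣≤-+ (A≤V k i j) (∣∣≤-neg (B≤W k i j)))
        (≤-reflexive (sym (×-homo-+ 1# V W))))
      (λ t 0<t _ → Vanishes-resp-≈
        (λ m → trans
          (+-cong (expSum-partialSum t A i j m) (-‿cong (expSum-partialSum t B i j m)))
          (sym (partialSum-sub (λ k → expTerm A k i j) (λ k → expTerm B k i j) t m)))
        (⟶⇒difference-vanishes
          (proj₂ (exp-converges (t •ₘ A) i j)) (proj₂ (exp-converges (t •ₘ B) i j))
          (expA≈expB t (<⇒≤ 0<t))))
      k))

-- Propagation of agreement along forces

module Forcing {c ℓ₁ ℓ₂} (ℝ : RealField c ℓ₁ ℓ₂) where

  open RealField ℝ
  open OrderProperties ℝ
  open ≤-Reasoning
  open MatrixExponential ℝ using (_*ₘ_; _^ₘ_)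
  open MatrixPowers ℝ
  open MarkovChain ℝ
  open import Algebra.Properties.Ring ring using (x[y-z]≈xy-xz; x≈y⇒x∙y⁻¹≈ε)
  open import Algebra.Properties.Semiring.Sum semiring

  -- By tightness, equality is the negation of apartness and hence stable. Thus the absence of an
  -- edge, a negative statement, yields a zero entry.
  ≈-stable : ∀ {x y} → ¬ ¬ (x ≈ y) → x ≈ y
  ≈-stable {x} {y} ¬x≉y =
    proj₁ (tight x y) (λ x#y → ¬x≉y (λ x≈y → proj₂ (tight x y) x≈y x#y))

  -- As `z` is merely unequal to `0#`, it need not be invertible constructively. If `x # y`,
  -- however, then `x - y` is invertible and z(x - y) = 0 forces z = 0.
  *-cancelˡ-≉0 : ∀ {z x y} → ¬ (z ≈ 0#) → z * x ≈ z * y → x ≈ y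
  *-cancelˡ-≉0 {z} {x} {y} z≉0 zx≈zy = proj₁ (tight x y) λ x#y →
    let [x-y]⁻¹ , _ , inverseʳ = #⇒invertible x#y in z≉0 (begin-equality
      z                          ≈⟨ *-identityʳ z ⟨
      z * 1#                     ≈⟨ *-congˡ inverseʳ ⟨
      z * ((x - y) * [x-y]⁻¹)    ≈⟨ *-assoc z _ _ ⟨
      z * (x - y) * [x-y]⁻¹      ≈⟨ *-congʳ (x[y-z]≈xy-xz z x y) ⟩
      (z * x - z * y) * [x-y]⁻¹  ≈⟨ *-congʳ (x≈y⇒x∙y⁻¹≈ε zx≈zy) ⟩
      0# * [x-y]⁻¹               ≈⟨ zeroˡ _ ⟩
      0#                         ∎)

  rowSum≈0 : ∀ {n} {Q : Matrix n} → IsTransitionRateMatrix Q → ∀ i → sum (Q i) ≈ 0#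
  rowSum≈0 {suc n} {Q} rate i = begin-equality
    sum (Q i)                     ≈⟨ sum-remove (Q i) ⟩
    Q i i + sum (removeAt (Q i) i) ≈⟨ +-cong (diagonal i) sum-off ⟩
    - sum off + sum off           ≈⟨ -‿inverseˡ (sum off) ⟩
    0#                            ∎
    where
    open IsTransitionRateMatrix rate
    off : Vector Carrier (suc n)
    off j = if does (i Fin.≟ j) then 0# else Q i j

    off-i : off i ≈ 0#
    off-i = reflexive (≡.cong (λ b → if b then 0# else Q i i) (dec-true (i Fin.≟ i) ≡.refl))

    off-≢ : ∀ j → i ≢ j → Q i j ≈ off j
    off-≢ j i≢j = reflexive (≡.cong (λ b → if b then 0# else Q i j) (≡.sym (dec-false (i Fin.≟ j) i≢j)))

    sum-off : sum (removeAt (Q i) i) ≈ sum off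
    sum-off = begin-equality
      sum (removeAt (Q i) i)         ≈⟨ sum-cong-≋ (λ l → off-≢ _ (Fin.punchInᵢ≢i i l ∘ ≡.sym)) ⟩
      sum (removeAt off i)           ≈⟨ +-identityˡ _ ⟨
      0# + sum (removeAt off i)      ≈⟨ +-congʳ off-i ⟨
      off i + sum (removeAt off i)   ≈⟨ sum-remove off ⟨
      sum off                        ∎

  -- An edge of `𝒢 M` records only the entry above the diagonal; combinatorial symmetry carries it
  -- to the entry below.
  adjacent⇒≉0 : ∀ {n} {M : Matrix n} → CombinatoriallySymmetric M →
                ∀ {i j} → Adj (𝒢 M) i j → ¬ (M i j ≈ 0#)
  adjacent⇒≉0 cs         (inj₁ (_ , Mij≉0)) = Mij≉0
  adjacent⇒≉0 cs {i} {j} (inj₂ (_ , Mji≉0)) = cs j i Mji≉0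

  nonadjacent⇒≈0 : ∀ {n} {M : Matrix n} → CombinatoriallySymmetric M →
                   ∀ {i j} → i ≢ j → ¬ Adj (𝒢 M) i j → M i j ≈ 0#
  nonadjacent⇒≈0 cs {i} {j} i≢j ¬adj with Fin.<-cmp i j
  ... | tri< i<j _ _ = ≈-stable (λ Mij≉0 → ¬adj (inj₁ (i<j , Mij≉0)))
  ... | tri≈ _ i≡j _ = contradiction i≡j i≢j
  ... | tri> _ _ j<i = ≈-stable (λ Mij≉0 → ¬adj (inj₂ (j<i , cs i j Mij≉0)))

  -- Models the row or column of a vertex that forces `j`: known on `B`, zero elsewhere, and open
  -- only at `j`.
  AgreeOn : ∀ {n} (B : Subset n) (j : Fin n) (u′ u : Vector Carrier n) → Set _
  AgreeOn B j u′ u = (∀ l → l ∈ B → u′ l ≈ u l) ×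
                     (∀ l → l ∉ B → l ≢ j → u′ l ≈ 0# × u l ≈ 0#)

  forced-coefficient : ∀ {n} {B : Subset n} {j} {u′ u : Vector Carrier n} →
    AgreeOn B j u′ u → sum u′ ≈ sum u → u′ j ≈ u j
  forced-coefficient {B = B} {j} {u′} {u} (u′≈u , u≈0) = sum-cancelAt j agree
    where
    agree : ∀ l → l ≢ j → u′ l ≈ u l
    agree l l≢j with l ∈? B
    ... | yes l∈B = u′≈u l l∈B
    ... | no  l∉B = let u′l≈0 , ul≈0 = u≈0 l l∉B l≢j in trans u′l≈0 (sym ul≈0)

  -- The products again satisfy `AgreeOn`: outside `B` the unknown values `f l` with `l ≢ j` are
  -- multiplied by zero. So the products agree at `j`, and the nonzero coefficient `u j` cancels.
  forced-value : ∀ {n} {B : Subset n} {j} {u′ u f′ f : Vector Carrier n} →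
    AgreeOn B j u′ u → u′ j ≈ u j → ¬ (u j ≈ 0#) →
    (∀ l → l ∈ B → f′ l ≈ f l) →
    ∑[ l < n ] (u′ l * f′ l) ≈ ∑[ l < n ] (u l * f l) → f′ j ≈ f j
  forced-value (u′≈u , u≈0) u′j≈uj uj≉0 f′≈f Σ≈Σ =
    *-cancelˡ-≉0 uj≉0 (trans (*-congʳ (sym u′j≈uj)) (forced-coefficient
      ( (λ l l∈B → *-cong (u′≈u l l∈B) (f′≈f l l∈B))
      , (λ l l∉B l≢j → let u′l≈0 , ul≈0 = u≈0 l l∉B l≢j in
          trans (*-congʳ u′l≈0) (zeroˡ _) , trans (*-congʳ ul≈0) (zeroˡ _)))
      Σ≈Σ))

  -- The invariant involves all exponents at once, because a force obtains exponent `k` at the new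
  -- vertex from exponent `suc k` on `B`.
  PowersAgreeOn : ∀ {n} (Q′ Q : Matrix n) → Subset n → Set _
  PowersAgreeOn Q′ Q B = ∀ {i j} → i ∈ B → j ∈ B → ∀ k → (Q′ ^ₘ k) i j ≈ (Q ^ₘ k) i j

  powers⇒entry : ∀ {n} {Q′ Q : Matrix n} {i j} →
    (∀ k → (Q′ ^ₘ k) i j ≈ (Q ^ₘ k) i j) → Q′ i j ≈ Q i j
  powers⇒entry {Q′ = Q′} {Q} {i = i} {j} agree =
    trans (sym (*ₘ-identityʳ Q′ i j)) (trans (agree 1) (*ₘ-identityʳ Q i j))

  module _ {n} {Q Q′ : Matrix n}
    (rate : IsTransitionRateMatrix Q) (rate′ : IsTransitionRateMatrix Q′)
    (cs : CombinatoriallySymmetric Q) (cs′ : CombinatoriallySymmetric Q′)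
    (𝒢′≈𝒢 : 𝒢 Q′ ≈ᴳ 𝒢 Q)
    where

    open ZeroForcing (𝒢 Q) using (_Forces_; force)

    powersAgree-force : ∀ {B C} → B Forces C → PowersAgreeOn Q′ Q B → PowersAgreeOn Q′ Q C
    powersAgree-force {B} (force {i} {j} i∈B j∉B i~j unique) agree = extended
      where
      nonadjacent : ∀ l → l ∉ B → l ≢ j → ¬ Adj (𝒢 Q) i l
      nonadjacent l l∉B l≢j i~l = l≢j (unique l i~l l∉B)

      -- The graph carries no information on diagonal entries, but these lie inside `B` since
      -- `i ∈ B`.
      i≢ : ∀ {l} → l ∉ B → i ≢ l
      i≢ l∉B ≡.refl = l∉B i∈B

      row : AgreeOn B j (Q′ i) (Q i)
      row = (λ l l∈B → powers⇒entry (agree i∈B l∈B))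
          , (λ l l∉B l≢j →
              nonadjacent⇒≈0 cs′ (i≢ l∉B) (nonadjacent l l∉B l≢j ∘ Equivalence.to (𝒢′≈𝒢 i l)) ,
              nonadjacent⇒≈0 cs  (i≢ l∉B) (nonadjacent l l∉B l≢j))

      column : AgreeOn B j (λ l → Q′ l i) (λ l → Q l i)
      column = (λ l l∈B → powers⇒entry (agree l∈B i∈B))
             , (λ l l∉B l≢j →
                 nonadjacent⇒≈0 cs′ (i≢ l∉B ∘ ≡.sym)
                   (nonadjacent l l∉B l≢j ∘ Graph.sym (𝒢 Q) ∘ Equivalence.to (𝒢′≈𝒢 l i)) ,
                 nonadjacent⇒≈0 cs  (i≢ l∉B ∘ ≡.sym) (nonadjacent l l∉B l≢j ∘ Graph.sym (𝒢 Q)))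

      Q′ij≈Qij : Q′ i j ≈ Q i j
      Q′ij≈Qij = forced-coefficient row (trans (rowSum≈0 rate′ i) (sym (rowSum≈0 rate i)))

      Qij≉0 : ¬ (Q i j ≈ 0#)
      Qij≉0 = adjacent⇒≉0 cs i~j

      -- Agreement at `suc k` is, by definition of the power, equality of the two expansions along
      -- row `i`.
      fromNew : ∀ {b} → b ∈ B → ∀ k → (Q′ ^ₘ k) j b ≈ (Q ^ₘ k) j b
      fromNew b∈B k = forced-value row Q′ij≈Qij Qij≉0
        (λ l l∈B → agree l∈B b∈B k) (agree i∈B b∈B (suc k))

      toNew : ∀ {b} → b ∈ B → ∀ k → (Q′ ^ₘ k) b j ≈ (Q ^ₘ k) b j
      -- Columns need not sum to zero, so the coefficient `Q j i` is taken from `fromNew` at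
      -- exponent 1 instead; it is nonzero by combinatorial symmetry.
      toNew {b} b∈B k = forced-value column (powers⇒entry (fromNew i∈B)) (cs i j Qij≉0)
        (λ l l∈B → agree b∈B l∈B k)
        (trans (sym (expand Q′)) (trans (agree b∈B i∈B (suc k)) (expand Q)))
        where
        expand : ∀ M → (M ^ₘ suc k) b i ≈ ∑[ l < n ] (M l i * (M ^ₘ k) b l)
        expand M = trans (^ₘ-sucʳ M k b i) (sum-cong-≋ (λ l → *-comm ((M ^ₘ k) b l) (M l i)))

      atNew : ∀ k → (Q′ ^ₘ k) j j ≈ (Q ^ₘ k) j j
      -- Row `i` is expanded once more, now towards `j`: both the values on `B` and the total come
      -- from `toNew`.
      atNew k = forced-value row Q′ij≈Qij Qij≉0 (λ l l∈B → toNew l∈B k) (toNew i∈B (suc k))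

      extended : PowersAgreeOn Q′ Q (B ∪ ⁅ j ⁆)
      extended x∈ y∈ k with x∈p∪q⁻ B ⁅ j ⁆ x∈ | x∈p∪q⁻ B ⁅ j ⁆ y∈
      ... | inj₁ x∈B | inj₁ y∈B = agree x∈B y∈B k
      ... | inj₁ x∈B | inj₂ y∈j with ≡.refl ← x∈⁅y⁆⇒x≡y j y∈j = toNew x∈B k
      ... | inj₂ x∈j | inj₁ y∈B with ≡.refl ← x∈⁅y⁆⇒x≡y j x∈j = fromNew y∈B k
      ... | inj₂ x∈j | inj₂ y∈j
        with ≡.refl ← x∈⁅y⁆⇒x≡y j x∈j | ≡.refl ← x∈⁅y⁆⇒x≡y j y∈j = atNew k

    zeroForcing⇒≈ : ∀ {Z} → IsZeroForcingSet (𝒢 Q) Z → PowersAgreeOn Q′ Q Z → ∀ i j → Q′ i j ≈ Q i j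
    zeroForcing⇒≈ Star.ε          agree i j = powers⇒entry (agree ∈⊤ ∈⊤)
    zeroForcing⇒≈ (step ◅ rest) agree     = zeroForcing⇒≈ rest (powersAgree-force step agree)

theorem2 :
    ∀ {c ℓ₁ ℓ₂} (ℝ : RealField c ℓ₁ ℓ₂) →
    let open RealField ℝ
        open MarkovChain ℝ
    in
    (S : ℕ) (Q : Matrix S) (Z : Subset S) →
    IsTransitionRateMatrix Q →
    CombinatoriallySymmetric Q →
    IsZeroForcingSet (𝒢 Q) Z →
    (Q′ : Matrix S) →
    IsTransitionRateMatrix Q′ →
    CombinatoriallySymmetric Q′ →
    𝒢 Q′ ≈ᴳ 𝒢 Q →
    (∀ i j → i ∈ Z → j ∈ Z → ∀ t → 0# ≤ t →
      transitionMatrix Q′ t i j ≈ transitionMatrix Q t i j) →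
    ∀ i j → Q′ i j ≈ Q i j
theorem2 ℝ S Q Z rate cs forcing Q′ rate′ cs′ 𝒢′≈𝒢 dynamics =
  zeroForcing⇒≈ rate rate′ cs cs′ 𝒢′≈𝒢 forcing
    (λ {i} {j} i∈Z j∈Z → exp-determines-powers Q′ Q i j (dynamics i j i∈Z j∈Z))
  where
  open Forcing ℝ
  open MatrixPowers ℝ
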